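{- Let $n\ge 4$ be an integer and let $G$ be an $(n-3)$-regular graph of order $n$. Then the bondage number of $G$ is $b(G)=n-3$.
   Context: Graphs $G=(V,E)$ are finite, undirected, without loops or multiple edges; the order of $G$ is $|V(G)|$. A subset $D\subseteq V(G)$ is a dominating set of $G$ if every vertex not in $D$ is adjacent to some vertex of $D$. The domination number $\gamma(G)$ is the minimum cardinality of a dominating set of $G$. For $B\subseteq E(G)$, $G-B$ denotes the graph with vertex set $V(G)$ and edge set $E(G)\setminus B$. For a graph $G$ with at least one edge, the bondage number is $b(G)=\min\{|B| : B\subseteq E(G),\ \gamma(G-B)>\gamma(G)\}$. -}

module Defs where

open import Data.Fin using (Fin; _<_)
open import Data.Fin.Properties using (all?; any?; _≟_)
open import Data.Fin.Subset using (Subset; _∈_; _∉_; ⊤; ∣_∣)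
open import Data.Fin.Subset.Properties using (_∈?_; anySubset?; ∈⊤)
open import Data.List using (List; length)
open import Data.List.Membership.Propositional as L using ()
open import Data.List.Relation.Unary.All using (All)
open import Data.List.Relation.Unary.Unique.Propositional using (Unique)
import Data.List.Membership.DecPropositional as DecMembership
open import Data.Nat as ℕ using (ℕ; zero; suc; _≤_; z≤n; s≤s)
open import Data.Product using (Σ; ∃; ∃-syntax; _×_; _,_; proj₁; proj₂)
open import Data.Product.Properties using (≡-dec)
open import Data.Vec using (tabulate)
open import Function using (_∘_)
open import Level using (0ℓ)
open import Relation.Binary using (Rel; Decidable; Symmetric; Irreflexive)
open import Relation.Binary.PropositionalEquality using (_≡_; refl)
open import Relation.Nullary using (does; yes; no; ¬?; contradiction; _×-dec_; _→-dec_)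
import Relation.Unary as U

private
  variable
    n : ℕ

record IsMinimum (P : ℕ → Set) (m : ℕ) : Set where
  field
    attained   : P m
    lowerBound : ∀ k → P k → m ≤ k

minimum : {P : ℕ → Set} → U.Decidable P → ∃ P → ∃ (IsMinimum P)
minimum {P} P? (k , p) = go P? k p
  where
  go : {Q : ℕ → Set} → U.Decidable Q → ∀ j → Q j → ∃ (IsMinimum Q)
  go Q? j q with Q? zero
  go Q? j       q | yes q₀ = zero , record { attained = q₀ ; lowerBound = λ _ _ → z≤n }
  go Q? zero    q | no ¬q₀ = contradiction q ¬q₀
  go Q? (suc j) q | no ¬q₀ with go (Q? ∘ suc) j q
  ... | m , min = suc m , record
    { attained   = IsMinimum.attained min
    ; lowerBound = λ where
        zero    q₀ → contradiction q₀ ¬q₀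
        (suc i) r  → s≤s (IsMinimum.lowerBound min i r)
    }

-- Decidability of adjacency is what makes the edge set of a graph on
-- Fin n finite constructively.
record Graph (n : ℕ) : Set₁ where
  field
    Adj    : Rel (Fin n) 0ℓ
    adj?   : Decidable Adj
    sym    : Symmetric Adj
    irrefl : Irreflexive _≡_ Adj

open Graph public using (Adj; adj?)

neighbours : Graph n → Fin n → Subset n
neighbours G v = tabulate (does ∘ adj? G v)

degree : Graph n → Fin n → ℕ
degree G v = ∣ neighbours G v ∣

Regular : ℕ → Graph n → Set
Regular k G = ∀ v → degree G v ≡ k

Dominating : Graph n → Subset n → Set
Dominating G D = ∀ v → v ∉ D → ∃[ u ] u ∈ D × Adj G v u

dominating? : (G : Graph n) → U.Decidable (Dominating G)
dominating? G D =
  all? λ v → ¬? (v ∈? D) →-dec any? λ u → (u ∈? D) ×-dec adj? G v u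

DominatingSetOfSize : Graph n → ℕ → Set
DominatingSetOfSize G k = ∃[ D ] Dominating G D × ∣ D ∣ ≡ k

-- The whole vertex set dominates, so the minimum exists.
dominationNumber : (G : Graph n) → ∃ (IsMinimum (DominatingSetOfSize G))
dominationNumber {n} G = minimum
  (λ k → anySubset? λ D → dominating? G D ×-dec (∣ D ∣ ℕ.≟ k))
  (∣ full ∣ , full , (λ _ v∉⊤ → contradiction ∈⊤ v∉⊤) , refl)
  where
  full = ⊤ {n}

γ : Graph n → ℕ
γ G = proj₁ (dominationNumber G)

-- The unordered pair {u, v} is represented by (u , v) with u < v, so
-- every edge has exactly one representative.
IsEdge : Graph n → Fin n × Fin n → Set
IsEdge G (u , v) = u < v × Adj G u v

-- A set of edges, listed without repetition so that length is cardinality.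
record EdgeSubset (G : Graph n) : Set where
  field
    elements : List (Fin n × Fin n)
    unique   : Unique elements
    areEdges : All (IsEdge G) elements

  size : ℕ
  size = length elements

open EdgeSubset public using (elements; size)

infixl 6 _-_

-- At most one of (u , v) and (v , u) can be listed in B; either one
-- removes the edge.
_-_ : (G : Graph n) → EdgeSubset G → Graph n
G - B = record
  { Adj    = λ u v → Adj G u v × (u , v) L.∉ elements B × (v , u) L.∉ elements B
  ; adj?   = λ u v → adj? G u v ×-dec ¬? ((u , v) ∈ₗ? elements B)
                                ×-dec ¬? ((v , u) ∈ₗ? elements B)
  ; sym    = λ (a , p , q) → Graph.sym G a , q , p
  ; irrefl = λ eq (a , _) → Graph.irrefl G eq a
  }
  where
  open DecMembership (≡-dec _≟_ _≟_) renaming (_∈?_ to _∈ₗ?_)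

-- Characterises b(G) as a relation because the minimum exists only when
-- G has an edge.
IsBondageNumber : Graph n → ℕ → Set
IsBondageNumber G = IsMinimum λ k →
  Σ (EdgeSubset G) λ B → size B ≡ k × γ (G - B) ℕ.> γ G

{-# OPTIONS --safe #-}

-- The complement H of G is 2-regular, so no vertex of G is universal and a
-- vertex stripped of its n - 3 edges leaves a graph with γ ≥ 3.  For the
-- converse, let γ(G - B) ≥ 3: any two vertices have a common neighbour in
-- K = H ∪ B.  Write d for the degree in B, so that Σ d = 2|B|; the claim is
-- 2|B| ≥ 2n - 7.
--   * If d ≥ 2 everywhere, this is immediate.
--   * If d v = 1 and d ≥ 1 everywhere, every vertex is K-adjacent to one of the
--     three K-neighbours a, b, c of v, and a, b, c span at least two edges, so
--     their K-degrees add up to at least n + 3 and d a + d b + d c ≥ n - 3; the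
--     other n - 3 vertices contribute at least 1 each.
--   * If d v = 0, the H-neighbours a, b of v satisfy d a + d b ≥ n - 3 in the same
--     way.  Let a′, b′ be the second H-neighbours of a, b.  Outside
--     {a, b, v, a′, b′} we have d ≥ 1, so 2|B| ≥ 2n - 8, and one more unit is
--     gained unless a′, b′, b are distinct and d a′ = d b′ = 0.  Then the second
--     H-neighbours a″, b″ of a′, b′ satisfy d a + d a″ ≥ n - 3 and
--     d b + d b″ ≥ n - 3, which suffices if a″ ≠ b″; if a″ = b″, this vertex is
--     B-adjacent to both a and b and supplies the missing unit.
-- With B empty, the converse also gives γ(G) ≤ 2.
module Submission where

open import Defs
open import Data.Nat using (ℕ; _≥_; _∸_)

open import Data.Nat using (zero; suc; _+_; _*_; _≤_; z≤n; s≤s; s≤s⁻¹; _≟_; _≤?_)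
open import Data.Nat.Properties
open import Data.Nat.Tactic.RingSolver using (solve-∀)
open import Algebra.Properties.Semiring.Sum +-*-semiring
  using (sum; sum-cong-≗; sum-replicate-zero; ∑-distrib-+; *-distribˡ-sum)
open import Data.Bool using (Bool; true; false)
open import Data.Fin as Fin using (Fin; zero; suc)
open import Data.Fin.Properties as Fin using (any?)
open import Data.Fin.Subset as Subset using (Subset; inside; outside; _∪_; ⁅_⁆; ∣_∣; _∈_)
open import Data.Fin.Subset.Properties using (_∈?_; x∈⁅x⁆; ∣⁅x⁆∣≡1; x∈p∪q⁺; x∈p∧x≢y⇒x∈p-y; x∈p⇒∣p-x∣<∣p∣)
open import Data.List as List using (List; []; _∷_; length; map)
open import Data.List.Properties using (length-map)
open import Data.List.Membership.Propositional as List using (_∉_)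
open import Data.List.Membership.Propositional.Properties using (∈-map⁺; ∈-filter⁺; ∈-allFin)
open import Data.List.Relation.Unary.All as All using (All; []; _∷_)
open import Data.List.Relation.Unary.AllPairs using ([]; _∷_)
open import Data.List.Relation.Unary.Any using (here; there)
open import Data.List.Relation.Unary.Unique.Propositional using (Unique)
import Data.List.Relation.Unary.All.Properties as All
import Data.List.Relation.Unary.Unique.Propositional.Properties as Unique
open import Data.Nat.ListAction using () renaming (sum to listSum)
open import Data.Product using (∃-syntax; _×_; _,_; proj₁; proj₂)
open import Data.Sum as Sum using (_⊎_; inj₁; inj₂; [_,_]′)
open import Data.Vec as Vec using ([]; _∷_)
open import Data.Vec.Functional using (updateAt)
open import Data.Vec.Functional.Properties using (updateAt-updates; updateAt-minimal)
open import Function using (_∘_; const; id; mk⇔)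
open import Relation.Binary.PropositionalEquality
open import Relation.Nullary using (¬_; Dec; does; yes; no; ¬?; contradiction; _×-dec_)
open import Relation.Nullary.Decidable using (does-⇔; decidable-stable)
import Relation.Unary as U

private
  variable
    n : ℕ

-- Inequalities and sums over `Fin n`.

cancel-≤ : ∀ c {l r p q} → l ≤ r → l ≡ c + p → r ≡ c + q → p ≤ q
cancel-≤ c l≤r refl refl = +-cancelˡ-≤ c _ _ l≤r

-- By parity the constant 7 counts as 6, so each case below only has to reach `2|B| ≥ 2n - 7`.
halve-≤ : ∀ n m → n + n ≤ 7 + (m + m) → n ≤ 3 + m
halve-≤ n m 2n≤ with n ≤? 3 + m
... | yes n≤ = n≤
... | no  n≰ = contradiction
  (≤-trans (≤-reflexive (eq m)) (≤-trans (+-mono-≤ (≰⇒> n≰) (≰⇒> n≰)) 2n≤))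
  (<-irrefl refl)
  where
  eq : ∀ m → 8 + (m + m) ≡ (4 + m) + (4 + m)
  eq = solve-∀

1≤m+n : ∀ m {n} → 1 ≤ m + n → 1 ≤ m ⊎ 1 ≤ n
1≤m+n zero    1≤n = inj₂ 1≤n
1≤m+n (suc m) _   = inj₁ (s≤s z≤n)

entry≤sum : (f : Fin n → ℕ) → ∀ i → f i ≤ sum f
entry≤sum f zero    = m≤m+n _ _
entry≤sum f (suc i) = ≤-trans (entry≤sum (f ∘ suc) i) (m≤n+m _ _)

sum-positive : (f : Fin n → ℕ) → 1 ≤ sum f → ∃[ i ] 1 ≤ f i
sum-positive {suc n} f 1≤ with 1≤m+n (f zero) 1≤
... | inj₁ 1≤f0 = zero , 1≤f0
... | inj₂ 1≤fs with sum-positive (f ∘ suc) 1≤fs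
... | i , 1≤fi = suc i , 1≤fi

sum-updateAt : (f : Fin n → ℕ) (i : Fin n) (φ : ℕ → ℕ) →
               sum (updateAt f i φ) + f i ≡ sum f + φ (f i)
sum-updateAt f zero φ = eq (φ (f zero)) (sum (f ∘ suc)) (f zero)
  where
  eq : ∀ p s x → (p + s) + x ≡ (x + s) + p
  eq = solve-∀
sum-updateAt f (suc i) φ = begin
  (f zero + sum (updateAt (f ∘ suc) i φ)) + f (suc i) ≡⟨ +-assoc (f zero) _ _ ⟩
  f zero + (sum (updateAt (f ∘ suc) i φ) + f (suc i)) ≡⟨ cong (f zero +_) (sum-updateAt (f ∘ suc) i φ) ⟩
  f zero + (sum (f ∘ suc) + φ (f (suc i)))            ≡⟨ +-assoc (f zero) _ _ ⟨
  (f zero + sum (f ∘ suc)) + φ (f (suc i))            ∎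
  where open ≡-Reasoning

sum-uniform-bound : ∀ t (f : Fin n → ℕ) → (∀ i → t ≤ f i) → n * t ≤ sum f
sum-uniform-bound {zero}  t f t≤ = z≤n
sum-uniform-bound {suc n} t f t≤ =
  +-mono-≤ (t≤ zero) (sum-uniform-bound t (f ∘ suc) (t≤ ∘ suc))

map-updateAt : (f : Fin n → ℕ) (i : Fin n) (φ : ℕ → ℕ) {L : List (Fin n)} →
               All (i ≢_) L → map (updateAt f i φ) L ≡ map f L
map-updateAt f i φ []          = refl
map-updateAt f i φ (i≢x ∷ i≢L) =
  cong₂ _∷_ (updateAt-minimal _ i f (i≢x ∘ sym)) (map-updateAt f i φ i≢L)

updateAt-bound : ∀ t (f : Fin n → ℕ) i j → (j ≢ i → t ≤ f j) →
                 t ≤ updateAt f i (const t) j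
updateAt-bound t f i j t≤ with j Fin.≟ i
... | yes refl = ≤-reflexive (sym (updateAt-updates i f))
... | no  j≢i  = ≤-trans (t≤ j≢i) (≤-reflexive (sym (updateAt-minimal j i f j≢i)))

-- Replacing the entries in L and E by t leaves a function bounded below by t
-- everywhere.
sum-lower-bound : ∀ t (L E : List (Fin n)) (f : Fin n → ℕ) → Unique L →
                  (∀ i → i ∉ L → i ∉ E → t ≤ f i) →
                  n * t + listSum (map f L) ≤ sum f + (length L + length E) * t
sum-lower-bound t [] [] f _ t≤ = +-monoˡ-≤ 0 (sum-uniform-bound t f λ i → t≤ i (λ ()) (λ ()))
sum-lower-bound {n} t [] (e ∷ E) f u t≤ = begin
  n * t + 0                        ≤⟨ sum-lower-bound t [] E f′ [] bound ⟩
  -- The value `f e` is discarded, so `E` may repeat entries or overlap `L`: such an entry is merely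
  -- charged `t` more than once.
  sum f′ + length E * t            ≤⟨ +-monoˡ-≤ _ (m≤m+n (sum f′) (f e)) ⟩
  (sum f′ + f e) + length E * t    ≡⟨ cong (_+ length E * t) (sum-updateAt f e (const t)) ⟩
  (sum f + t) + length E * t       ≡⟨ +-assoc (sum f) t _ ⟩
  sum f + (t + length E * t)       ∎
  where
  open ≤-Reasoning
  f′ = updateAt f e (const t)
  bound : ∀ i → i ∉ [] → i ∉ E → t ≤ f′ i
  bound i i∉ i∉E = updateAt-bound t f e i λ i≢e → t≤ i i∉ λ
    { (here i≡e) → i≢e i≡e ; (there i∈E) → i∉E i∈E }
sum-lower-bound {n} t (a ∷ L) E f (a∉L ∷ u) t≤ = begin
  n * t + (f a + listSum (map f L))   ≡⟨ eq₁ (n * t) (f a) _ ⟩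
  n * t + listSum (map f L) + f a     ≡⟨ cong (λ l → n * t + listSum l + f a) (map-updateAt f a (const t) a∉L) ⟨
  n * t + listSum (map f′ L) + f a    ≤⟨ +-monoˡ-≤ (f a) (sum-lower-bound t L E f′ u bound) ⟩
  (sum f′ + k * t) + f a               ≡⟨ eq₂ (sum f′) (k * t) (f a) ⟩
  (sum f′ + f a) + k * t               ≡⟨ cong (_+ k * t) (sum-updateAt f a (const t)) ⟩
  (sum f + t) + k * t                  ≡⟨ +-assoc (sum f) t _ ⟩
  sum f + (t + k * t)                  ∎
  where
  open ≤-Reasoning
  f′ = updateAt f a (const t)
  k  = length L + length E
  eq₁ : ∀ x y z → x + (y + z) ≡ (x + z) + y
  eq₁ = solve-∀
  eq₂ : ∀ x y z → (x + y) + z ≡ (x + z) + y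
  eq₂ = solve-∀
  bound : ∀ i → i ∉ L → i ∉ E → t ≤ f′ i
  bound i i∉L = updateAt-bound t f a i ∘ λ i∉E i≢a → t≤ i (λ
    { (here i≡a) → i≢a i≡a ; (there i∈L) → i∉L i∈L }) i∉E

sum≡1⇒unique-support : (f : Fin n → ℕ) → sum f ≡ 1 →
                       ∃[ c ] 1 ≤ f c × (∀ i → 1 ≤ f i → i ≡ c)
sum≡1⇒unique-support f Σf≡1 with sum-positive f (≤-reflexive (sym Σf≡1))
... | c , 1≤fc = c , 1≤fc , unique
  where
  f′ = updateAt f c (const 0)
  unique : ∀ i → 1 ≤ f i → i ≡ c
  unique i 1≤fi with i Fin.≟ c
  ... | yes i≡c = i≡c
  ... | no  i≢c = contradiction
    (≤-trans (+-mono-≤ (≤-trans (≤-trans 1≤fi (≤-reflexive (sym (updateAt-minimal i c f i≢c)))) (entry≤sum f′ i)) 1≤fc)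
      (≤-reflexive (trans (sum-updateAt f c (const 0)) (trans (+-identityʳ _) Σf≡1))))
    λ { (s≤s ()) }

-- By `f≤1` the entry at `y` is exactly 1; zeroing it leaves a function of sum 1, whose support is a
-- single point.
sum≡2⇒second-support : (f : Fin n → ℕ) → sum f ≡ 2 → (∀ i → f i ≤ 1) → ∀ {y} → 1 ≤ f y →
                       ∃[ z ] z ≢ y × 1 ≤ f z × (∀ i → 1 ≤ f i → i ≡ y ⊎ i ≡ z)
sum≡2⇒second-support f Σf≡2 f≤1 {y} 1≤fy with sum≡1⇒unique-support f′ Σf′≡1
  where
  f′ = updateAt f y (const 0)
  Σf′≡1 : sum f′ ≡ 1
  Σf′≡1 = +-cancelʳ-≡ 1 _ _ (trans (cong (sum f′ +_) (≤-antisym 1≤fy (f≤1 y)))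
            (trans (sum-updateAt f y (const 0)) (trans (+-identityʳ _) Σf≡2)))
... | z , 1≤f′z , unique = z , z≢y ,
      ≤-trans 1≤f′z (≤-reflexive (updateAt-minimal z y f z≢y)) , only
  where
  z≢y : z ≢ y
  z≢y refl = contradiction (≤-trans 1≤f′z (≤-reflexive (updateAt-updates z f))) λ ()
  only : ∀ i → 1 ≤ f i → i ≡ y ⊎ i ≡ z
  only i 1≤fi with i Fin.≟ y
  ... | yes i≡y = inj₁ i≡y
  ... | no  i≢y = inj₂ (unique i (≤-trans 1≤fi (≤-reflexive (sym (updateAt-minimal i y f i≢y)))))

-- Counting in a 2-regular graph with added edges.

-- h is the adjacency matrix of the complement of G and β that of the removed
-- edges, so that κ describes the complement of G - B.
module TwoRegularPlus {n m : ℕ} (h β : Fin n → Fin n → ℕ)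
  (h-sym : ∀ x y → h x y ≡ h y x) (β-sym : ∀ x y → β x y ≡ β y x)
  (h-irrefl : ∀ x → h x x ≡ 0) (β-irrefl : ∀ x → β x x ≡ 0)
  (h≤1 : ∀ x y → h x y ≤ 1) (h-degree : ∀ x → sum (h x) ≡ 2)
  (disjoint : ∀ x y → 1 ≤ h x y → β x y ≡ 0)
  (handshake : sum (λ x → sum (β x)) ≡ m + m)
  where

  κ : Fin n → Fin n → ℕ
  κ x y = h x y + β x y

  d : Fin n → ℕ
  d x = sum (β x)

  κ-sym : ∀ {x y} → 1 ≤ κ x y → 1 ≤ κ y x
  κ-sym {x} {y} = subst (1 ≤_) (cong₂ _+_ (h-sym x y) (β-sym x y))

  h⇒κ : ∀ {x y} → 1 ≤ h x y → 1 ≤ κ x y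
  h⇒κ 1≤h = ≤-trans 1≤h (m≤m+n _ _)

  h-sym′ : ∀ {x y} → 1 ≤ h x y → 1 ≤ h y x
  h-sym′ {x} {y} = subst (1 ≤_) (h-sym x y)

  h⇒≢ : ∀ {x y} → 1 ≤ h x y → x ≢ y
  h⇒≢ {x} 1≤h refl = contradiction (≤-trans 1≤h (≤-reflexive (h-irrefl x))) λ ()

  κ-irrefl : ∀ x → κ x x ≡ 0
  κ-irrefl x = cong₂ _+_ (h-irrefl x) (β-irrefl x)

  β⇒d : ∀ {x y} → 1 ≤ β x y → 1 ≤ d x
  β⇒d {x} {y} 1≤β = ≤-trans 1≤β (entry≤sum (β x) y)

  β-sym′ : ∀ {x y} → 1 ≤ β x y → 1 ≤ β y x
  β-sym′ {x} {y} = subst (1 ≤_) (β-sym x y)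

  κ-degree : ∀ x → sum (κ x) ≡ 2 + d x
  κ-degree x = trans (∑-distrib-+ (h x) (β x)) (cong (_+ d x) (h-degree x))

  record Nbrs (x y z : Fin n) : Set where
    constructor nbrs
    field
      distinct : z ≢ y
      left     : 1 ≤ h x y
      right    : 1 ≤ h x z
      only     : ∀ w → 1 ≤ h x w → w ≡ y ⊎ w ≡ z

  second-nbr : ∀ {x y} → 1 ≤ h x y → ∃[ z ] Nbrs x y z
  second-nbr {x} 1≤hxy with sum≡2⇒second-support (h x) (h-degree x) (h≤1 x) 1≤hxy
  ... | z , z≢y , 1≤hxz , only = z , nbrs z≢y 1≤hxy 1≤hxz only

  some-nbrs : ∀ x → ∃[ y ] ∃[ z ] Nbrs x y z
  some-nbrs x with sum-positive (h x) (≤-trans (s≤s z≤n) (≤-reflexive (sym (h-degree x))))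
  ... | y , 1≤hxy = y , second-nbr 1≤hxy

  module _ (common : ∀ u v → u ≢ v → ∃[ w ] 1 ≤ κ u w × 1 ≤ κ v w) where

    -- The vertex is a parameter because the results are used for `v` and again for `a′` and `b′`.
    module Isolated {v a b : Fin n} (dv≡0 : d v ≡ 0) (N : Nbrs v a b) where
      open Nbrs N renaming (distinct to b≢a; left to va; right to vb; only to v-only)

      βv≡0 : ∀ x → ¬ 1 ≤ β v x
      βv≡0 x 1≤β = contradiction (≤-trans (β⇒d 1≤β) (≤-reflexive dv≡0)) λ ()

      -- With no B-edge at `v`, the only candidates for a common neighbour of `v` and `x` are `a`
      -- and `b`.
      cover : ∀ x → x ≢ v → 1 ≤ κ a x + κ b x
      cover x x≢v with common v x (x≢v ∘ sym)
      ... | w , κvw , κxw with 1≤m+n (h v w) κvw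
      ...   | inj₂ βvw = contradiction βvw (βv≡0 w)
      ...   | inj₁ hvw with v-only w hvw
      ...     | inj₁ refl = ≤-trans (κ-sym κxw) (m≤m+n _ _)
      ...     | inj₂ refl = ≤-trans (κ-sym κxw) (m≤n+m _ (κ a x))

      -- Take `x = a` in `cover`: since `a` is not adjacent to itself, `b` must cover it.
      κab : 1 ≤ κ a b
      κab with 1≤m+n (κ a a) (cover a (h⇒≢ (h-sym′ va)))
      ... | inj₁ 1≤κaa = contradiction (≤-trans 1≤κaa (≤-reflexive (κ-irrefl a))) λ ()
      ... | inj₂ 1≤κba = κ-sym 1≤κba

      -- Sum `cover` over all vertices. As `v` is adjacent to both `a` and `b`, it counts twice, so
      -- `n + 1 ≤ (2 + d a) + (2 + d b)`.
      degree-sum : n ≤ 3 + (d a + d b)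
      degree-sum = arith (+-mono-≤ (κ-sym (h⇒κ va)) (κ-sym (h⇒κ vb)))
        (≤-trans (sum-lower-bound 1 (v ∷ []) [] f ([] ∷ []) λ i i∉ _ → cover i (i∉ ∘ here))
          (≤-reflexive (cong (_+ 1) (trans (∑-distrib-+ (κ a) (κ b)) (cong₂ _+_ (κ-degree a) (κ-degree b))))))
        where
        f : Fin n → ℕ
        f x = κ a x + κ b x
        eq₁ : ∀ n → n * 1 + 2 ≡ 2 + n
        eq₁ = solve-∀
        eq₂ : ∀ a b → 2 + a + (2 + b) + 1 ≡ 2 + (3 + (a + b))
        eq₂ = solve-∀
        arith : ∀ {n y a b} → 2 ≤ y → n * 1 + (y + 0) ≤ (2 + a) + (2 + b) + 1 → n ≤ 3 + (a + b)
        arith {n} {y} {a} {b} 2≤y le = cancel-≤ 2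
          (≤-trans (+-monoʳ-≤ (n * 1) (≤-trans 2≤y (m≤m+n y 0))) le) (eq₁ n) (eq₂ a b)

    isolated : ∀ {v} → d v ≡ 0 → n ≤ 3 + m
    isolated {v} dv≡0 with some-nbrs v
    ... | a , b , N with second-nbr (h-sym′ (Nbrs.left N)) | second-nbr (h-sym′ (Nbrs.right N))
    ... | a′ , Na | b′ , Nb = result
      where
      open Isolated dv≡0 N
      open Nbrs N using () renaming (distinct to b≢a; left to va; right to vb; only to v-only)
      open Nbrs Na using () renaming (distinct to a′≢v; right to aa′; only to a-only)
      open Nbrs Nb using () renaming (distinct to b′≢v; right to bb′; only to b-only)

      -- By `cover`, `x` is joined to `a` or `b`. The H-neighbours of these are `v`, `a′` and `b′`,
      -- so for any other `x` the edge lies in B.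
      d-positive : ∀ x → x ≢ v → x ≢ a′ → x ≢ b′ → 1 ≤ d x
      d-positive x x≢v x≢a′ x≢b′ with 1≤m+n (κ a x) (cover x x≢v)
      ... | inj₁ κax with 1≤m+n (h a x) κax
      ...   | inj₁ hax = contradiction (a-only x hax) [ x≢v , x≢a′ ]′
      ...   | inj₂ βax = β⇒d (β-sym′ βax)
      d-positive x x≢v x≢a′ x≢b′ | inj₂ κbx with 1≤m+n (h b x) κbx
      ...   | inj₁ hbx = contradiction (b-only x hbx) [ x≢v , x≢b′ ]′
      ...   | inj₂ βbx = β⇒d (β-sym′ βbx)

      -- The degree sum is at least `(n - 4) + (d a + d b)`, hence at least
      -- `(n - 4) + (n - 3) = 2n - 7`.
      two-exceptions : ∀ p q → (∀ x → x ≢ a → x ≢ b → x ≢ p → x ≢ q → 1 ≤ d x) → n ≤ 3 + m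
      two-exceptions p q pos = halve-≤ n m (arith (d a) (d b) degree-sum
        (≤-trans (sum-lower-bound 1 (a ∷ b ∷ []) (p ∷ q ∷ []) d ((b≢a ∘ sym ∷ []) ∷ [] ∷ [])
                   λ x x∉ x∉′ → pos x (x∉ ∘ here) (x∉ ∘ there ∘ here) (x∉′ ∘ here) (x∉′ ∘ there ∘ here))
          (≤-reflexive (cong (_+ 4) handshake))))
        where
        eq₁ : ∀ n a b → n * 1 + (a + (b + 0)) + n ≡ (a + b) + (n + n)
        eq₁ = solve-∀
        eq₂ : ∀ m a b → (m + m + 4) + (3 + (a + b)) ≡ (a + b) + (7 + (m + m))
        eq₂ = solve-∀
        arith : ∀ a b → n ≤ 3 + (a + b) → n * 1 + (a + (b + 0)) ≤ m + m + 4 → n + n ≤ 7 + (m + m)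
        arith a b n≤ le = cancel-≤ (a + b) (+-mono-≤ le n≤) (eq₁ n a b) (eq₂ m a b)

      result : n ≤ 3 + m
      result with a′ Fin.≟ b | a′ Fin.≟ b′ | d a′ ≟ 0 | d b′ ≟ 0
      -- In the first four cases one of `a′`, `b′` is no extra exception: `a′` is `b`, the two
      -- coincide, or one of them has positive degree.
      ... | yes refl | _ | _ | _ = two-exceptions v b′ λ x _ x≢b x≢v x≢b′ → d-positive x x≢v x≢b x≢b′
      ... | no _ | yes refl | _ | _ = two-exceptions v b′ λ x _ _ x≢v x≢b′ → d-positive x x≢v x≢b′ x≢b′
      ... | no _ | no _ | no da′≢0 | _ = two-exceptions v b′ pos
        where
        pos : ∀ x → x ≢ a → x ≢ b → x ≢ v → x ≢ b′ → 1 ≤ d x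
        pos x _ _ x≢v x≢b′ with x Fin.≟ a′
        ... | yes refl = n≢0⇒n>0 da′≢0
        ... | no x≢a′  = d-positive x x≢v x≢a′ x≢b′
      ... | no _ | no _ | yes _ | no db′≢0 = two-exceptions v a′ pos
        where
        pos : ∀ x → x ≢ a → x ≢ b → x ≢ v → x ≢ a′ → 1 ≤ d x
        pos x _ _ x≢v x≢a′ with x Fin.≟ b′
        ... | yes refl = n≢0⇒n>0 db′≢0
        ... | no x≢b′  = d-positive x x≢v x≢a′ x≢b′
      ... | no a′≢b | no a′≢b′ | yes da′≡0 | yes db′≡0
        with second-nbr (h-sym′ aa′) | second-nbr (h-sym′ bb′)
      ... | a″ , Na′ | b″ , Nb′ = cases (a″ Fin.≟ b″)
        where
        open Nbrs Na′ using () renaming (distinct to a″≢a; right to a′a″)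
        open Nbrs Nb′ using () renaming (distinct to b″≢b; right to b′b″)

        -- If `a = b′`, then `b` is an H-neighbour of `a`, so it is `v` or `a′`; both are excluded.
        a≢b′ : a ≢ b′
        a≢b′ refl = [ h⇒≢ (h-sym′ vb) , a′≢b ∘ sym ]′ (a-only b (h-sym′ bb′))

        a″≢b : a″ ≢ b
        a″≢b refl = [ a′≢v , a′≢b′ ]′ (b-only a′ (h-sym′ a′a″))

        b″≢a : b″ ≢ a
        b″≢a refl = [ b′≢v , a′≢b′ ∘ sym ]′ (a-only b′ (h-sym′ b′b″))

        -- `κab` at the isolated vertex `a′` joins `a` to `a″`. An H-edge would make `a″` equal to
        -- `a′` or `v`, and `a″ = v` would put `a′` among the H-neighbours `a`, `b` of `v`.
        βaa″ : 1 ≤ β a″ a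
        βaa″ with 1≤m+n (h a a″) (Isolated.κab da′≡0 Na′)
        ... | inj₂ β = β-sym′ β
        ... | inj₁ h with a-only a″ h
        ...   | inj₂ refl = contradiction refl (h⇒≢ a′a″)
        ...   | inj₁ refl = contradiction (v-only a′ (h-sym′ a′a″)) [ h⇒≢ (h-sym′ aa′) , a′≢b ]′

        βbb″ : 1 ≤ β b″ b
        βbb″ with 1≤m+n (h b b″) (Isolated.κab db′≡0 Nb′)
        ... | inj₂ β = β-sym′ β
        ... | inj₁ h with b-only b″ h
        ...   | inj₂ refl = contradiction refl (h⇒≢ b′b″)
        ...   | inj₁ refl = contradiction (v-only b′ (h-sym′ b′b″)) [ a≢b′ ∘ sym , h⇒≢ (h-sym′ bb′) ]′

        2≤d : a″ ≡ b″ → 2 ≤ d a″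
        -- With threshold 0, `sum-lower-bound` says that distinct listed entries add up to at most
        -- the whole sum.
        2≤d refl = arith (β a″ a) (β a″ b) βaa″ βbb″ (sum-lower-bound 0 (a ∷ b ∷ []) [] (β a″)
                     ((b≢a ∘ sym ∷ []) ∷ [] ∷ []) λ _ _ _ → z≤n)
          where
          arith : ∀ x y {s} → 1 ≤ x → 1 ≤ y → n * 0 + (x + (y + 0)) ≤ s + 0 → 2 ≤ s
          arith x y {s} 1≤x 1≤y le = begin
            2                      ≤⟨ +-mono-≤ 1≤x (≤-trans 1≤y (m≤m+n y 0)) ⟩
            x + (y + 0)            ≤⟨ m≤n+m _ (n * 0) ⟩
            n * 0 + (x + (y + 0))  ≤⟨ le ⟩
            s + 0                  ≡⟨ +-identityʳ s ⟩
            s                      ∎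
            where open ≤-Reasoning

        cases : _ → n ≤ 3 + m
        -- Six entries are set apart, and `a″` contributes 2: `(n - 6) + (n - 3) + 2 = 2n - 7`.
        cases (yes a″≡b″) = halve-≤ n m (arith (d a) (d b) degree-sum (2≤d a″≡b″)
          (≤-trans (sum-lower-bound 1 (a ∷ b ∷ a″ ∷ []) (v ∷ a′ ∷ b′ ∷ []) d
                     ((b≢a ∘ sym ∷ a″≢a ∘ sym ∷ []) ∷ (a″≢b ∘ sym ∷ []) ∷ [] ∷ [])
                     λ x _ x∉ → d-positive x (x∉ ∘ here) (x∉ ∘ there ∘ here) (x∉ ∘ there ∘ there ∘ here))
            (≤-reflexive (cong (_+ 6) handshake))))
          where
          eq₁ : ∀ n a b → n * 1 + (a + (b + (2 + 0))) + n ≡ (2 + (a + b)) + (n + n)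
          eq₁ = solve-∀
          eq₂ : ∀ m a b → (m + m + 6) + (3 + (a + b)) ≡ (2 + (a + b)) + (7 + (m + m))
          eq₂ = solve-∀
          arith : ∀ a b {c} → n ≤ 3 + (a + b) → 2 ≤ c →
                  n * 1 + (a + (b + (c + 0))) ≤ m + m + 6 → n + n ≤ 7 + (m + m)
          arith a b n≤ 2≤c le = cancel-≤ (2 + (a + b))
            (+-mono-≤ (≤-trans (+-monoʳ-≤ (n * 1) (+-monoʳ-≤ a (+-monoʳ-≤ b (+-monoˡ-≤ 0 2≤c)))) le) n≤)
            (eq₁ n a b) (eq₂ m a b)
        -- Four distinct vertices already carry `2(n - 3) = 2n - 6`, one more than required.
        cases (no a″≢b″) = halve-≤ n m (arith (d a) (d a″) (d b) (d b″) (Isolated.degree-sum da′≡0 Na′) (Isolated.degree-sum db′≡0 Nb′)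
          (≤-trans (sum-lower-bound 0 (a ∷ a″ ∷ b ∷ b″ ∷ []) [] d
                     ((a″≢a ∘ sym ∷ b≢a ∘ sym ∷ b″≢a ∘ sym ∷ []) ∷ (a″≢b ∷ a″≢b″ ∷ []) ∷ (b″≢b ∘ sym ∷ []) ∷ [] ∷ [])
                     λ _ _ _ → z≤n)
            (≤-reflexive (cong (_+ 0) handshake))))
          where
          eq₁ : ∀ n a b c e → n * 0 + (a + (b + (c + (e + 0)))) + (n + n) ≡ (a + b + (c + e)) + (n + n)
          eq₁ = solve-∀
          eq₂ : ∀ m a b c e → (m + m + 1) + ((3 + (a + b)) + (3 + (c + e))) ≡ (a + b + (c + e)) + (7 + (m + m))
          eq₂ = solve-∀
          arith : ∀ a b c e → n ≤ 3 + (a + b) → n ≤ 3 + (c + e) →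
                  n * 0 + (a + (b + (c + (e + 0)))) ≤ m + m + 0 → n + n ≤ 7 + (m + m)
          arith a b c e n≤₁ n≤₂ le = cancel-≤ (a + b + (c + e))
            (+-mono-≤ (≤-trans le (+-monoʳ-≤ (m + m) z≤n)) (+-mono-≤ n≤₁ n≤₂))
            (eq₁ n a b c e) (eq₂ m a b c e)

    pendant : (∀ x → 1 ≤ d x) → ∀ {v} → d v ≡ 1 → n ≤ 3 + m
    pendant 1≤d {v} dv≡1 with some-nbrs v | sum≡1⇒unique-support (β v) dv≡1
    -- In the K-degree sum of `a`, `b`, `c`, the vertex `v` counts 3 and `a`, `b`, `c` together
    -- count at least 4, so `(n - 4) + 3 + 4 ≤ 6 + d a + d b + d c`. The second count adds `n - 3`
    -- for the vertices other than `a`, `b`, `c`.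
    ... | a , b , nbrs b≢a va vb v-only | c , vc , β-only = halve-≤ n m (finish
          (two-edges (κ a b) (κ a c) (κ b c) meets-a meets-b meets-c) v-triple
          (≤-trans (sum-lower-bound 1 (v ∷ a ∷ b ∷ c ∷ []) [] f
                     ((h⇒≢ va ∷ h⇒≢ vb ∷ v≢c ∷ []) ∷ (b≢a ∘ sym ∷ a≢c ∷ []) ∷ (b≢c ∷ []) ∷ [] ∷ [])
                     λ x x∉ _ → cover x (x∉ ∘ here))
            (≤-reflexive (cong (_+ 4) Σf)))
          (≤-trans (sum-lower-bound 1 (a ∷ b ∷ c ∷ []) [] d
                     ((b≢a ∘ sym ∷ a≢c ∷ []) ∷ (b≢c ∷ []) ∷ [] ∷ []) λ x _ _ → 1≤d x)
            (≤-reflexive (cong (_+ 3) handshake))))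
      where
      v≢c : v ≢ c
      v≢c refl = contradiction (≤-trans vc (≤-reflexive (β-irrefl v))) λ ()

      -- `c` is the B-neighbour of `v`, and H and B share no edge.
      h⇒≢c : ∀ {x} → 1 ≤ h v x → x ≢ c
      h⇒≢c {x} vx refl = contradiction (≤-trans vc (≤-reflexive (disjoint v x vx))) λ ()

      a≢c = h⇒≢c va
      b≢c = h⇒≢c vb

      f : Fin n → ℕ
      f x = κ a x + (κ b x + κ c x)

      Σf : sum f ≡ (2 + d a) + ((2 + d b) + (2 + d c))
      Σf = trans (∑-distrib-+ (κ a) _) (cong₂ _+_ (κ-degree a)
             (trans (∑-distrib-+ (κ b) (κ c)) (cong₂ _+_ (κ-degree b) (κ-degree c))))

      cover : ∀ x → x ≢ v → 1 ≤ f x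
      cover x x≢v with common v x (x≢v ∘ sym)
      ... | w , κvw , κxw with 1≤m+n (h v w) κvw
      ... | inj₂ βvw with refl ← β-only w βvw =
              ≤-trans (κ-sym κxw) (≤-trans (m≤n+m (κ c x) (κ b x)) (m≤n+m _ (κ a x)))
      ... | inj₁ hvw with v-only w hvw
      ...   | inj₁ refl = ≤-trans (κ-sym κxw) (m≤m+n _ _)
      ...   | inj₂ refl = ≤-trans (κ-sym κxw) (≤-trans (m≤m+n (κ b x) (κ c x)) (m≤n+m _ (κ a x)))

      v-triple : 3 ≤ f v
      v-triple = +-mono-≤ (κ-sym (h⇒κ va)) (+-mono-≤ (κ-sym (h⇒κ vb))
                   (κ-sym (≤-trans vc (m≤n+m _ _))))

      κ-comm : ∀ x y → κ x y ≡ κ y x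
      κ-comm x y = cong₂ _+_ (h-sym x y) (β-sym x y)

      f-a : f a ≡ κ a b + κ a c
      f-a = cong₂ _+_ (κ-irrefl a) (cong₂ _+_ (κ-comm b a) (κ-comm c a))
      f-b : f b ≡ κ a b + κ b c
      f-b = cong (κ a b +_) (cong₂ _+_ (κ-irrefl b) (κ-comm c b))
      f-c : f c ≡ κ a c + κ b c
      f-c = cong (κ a c +_) (trans (cong (κ b c +_) (κ-irrefl c)) (+-identityʳ _))

      meets-a : 1 ≤ κ a b + κ a c
      meets-a = ≤-trans (cover a (h⇒≢ (h-sym′ va))) (≤-reflexive f-a)
      meets-b : 1 ≤ κ a b + κ b c
      meets-b = ≤-trans (cover b (h⇒≢ (h-sym′ vb))) (≤-reflexive f-b)
      meets-c : 1 ≤ κ a c + κ b c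
      meets-c = ≤-trans (cover c (v≢c ∘ sym)) (≤-reflexive f-c)

      -- `p`, `q`, `r` count the edges `ab`, `ac`, `bc`. A single edge would miss one of the three
      -- vertices.
      two-edges : ∀ p q r → 1 ≤ p + q → 1 ≤ p + r → 1 ≤ q + r → 2 ≤ p + (q + r)
      two-edges zero q r 1≤q 1≤r _ = +-mono-≤ 1≤q 1≤r
      two-edges (suc p) q r _ _ 1≤q+r = s≤s (≤-trans 1≤q+r (m≤n+m _ p))

      finish : 2 ≤ κ a b + (κ a c + κ b c) → 3 ≤ f v →
               n * 1 + (f v + (f a + (f b + (f c + 0)))) ≤ (2 + d a) + ((2 + d b) + (2 + d c)) + 4 →
               n * 1 + (d a + (d b + (d c + 0))) ≤ m + m + 3 → n + n ≤ 7 + (m + m)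
      finish 2≤ 3≤ rewrite f-a | f-b | f-c = arith (κ a b) (κ a c) (κ b c) (d a) (d b) (d c) 2≤ 3≤
        where
        eq₀ : ∀ p q r → (p + (q + r)) + (p + (q + r)) ≡ p + q + (p + r + (q + r + 0))
        eq₀ = solve-∀
        eq₁ : ∀ n a b c → n * 1 + 7 + (n * 1 + (a + (b + (c + 0)))) ≡ (7 + (a + b + c)) + (n + n)
        eq₁ = solve-∀
        eq₂ : ∀ m a b c → ((2 + a) + ((2 + b) + (2 + c)) + 4) + (m + m + 4) ≡ (7 + (a + b + c)) + (7 + (m + m))
        eq₂ = solve-∀
        arith : ∀ p q r a b c {y} → 2 ≤ p + (q + r) → 3 ≤ y →
                n * 1 + (y + (p + q + (p + r + (q + r + 0)))) ≤ (2 + a) + ((2 + b) + (2 + c)) + 4 →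
                n * 1 + (a + (b + (c + 0))) ≤ m + m + 3 → n + n ≤ 7 + (m + m)
        arith p q r a b c 2≤ 3≤ le₁ le₂ = cancel-≤ (7 + (a + b + c))
          (+-mono-≤ (≤-trans (+-monoʳ-≤ (n * 1) (+-mono-≤ 3≤ (≤-trans (+-mono-≤ 2≤ 2≤) (≤-reflexive (eq₀ p q r))))) le₁)
            (≤-trans le₂ (+-monoʳ-≤ (m + m) (n≤1+n 3))))
          (eq₁ n a b c) (eq₂ m a b c)

    order-bound : n ≤ 3 + m
    order-bound with any? (λ v → d v ≟ 0)
    ... | yes (v , dv≡0) = isolated dv≡0
    ... | no no-isolated with any? (λ v → d v ≟ 1)
    ...   | yes (v , dv≡1) = pendant (λ x → n≢0⇒n>0 λ eq → no-isolated (x , eq)) dv≡1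
    ...   | no no-pendant = halve-≤ n m (begin
      n + n                  ≡⟨ eq n ⟩
      n * 2                  ≤⟨ sum-uniform-bound 2 d (λ x → 2≤ (d x) (λ eq → no-isolated (x , eq)) (λ eq → no-pendant (x , eq))) ⟩
      sum d                  ≡⟨ handshake ⟩
      m + m                  ≤⟨ m≤n+m _ 7 ⟩
      7 + (m + m)            ∎)
      where
      open ≤-Reasoning
      eq : ∀ n → n + n ≡ n * 2
      eq = solve-∀
      2≤ : ∀ k → k ≢ 0 → k ≢ 1 → 2 ≤ k
      2≤ zero k≢0 _ = contradiction refl k≢0
      2≤ (suc zero) _ k≢1 = contradiction refl k≢1
      2≤ (suc (suc k)) _ _ = s≤s (s≤s z≤n)

-- Indicators and adjacency matrices of edge lists.

⟦_⟧ : Bool → ℕ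
⟦ true  ⟧ = 1
⟦ false ⟧ = 0

⟦⟧≤1 : ∀ b → ⟦ b ⟧ ≤ 1
⟦⟧≤1 true  = s≤s z≤n
⟦⟧≤1 false = z≤n

⟦does⟧⁺ : ∀ {P : Set} (P? : Dec P) → P → 1 ≤ ⟦ does P? ⟧
⟦does⟧⁺ (yes _) _ = s≤s z≤n
⟦does⟧⁺ (no ¬p) p = contradiction p ¬p

⟦does⟧⁻ : ∀ {P : Set} (P? : Dec P) → 1 ≤ ⟦ does P? ⟧ → P
⟦does⟧⁻ (yes p) _ = p

δ : Fin n → Fin n → ℕ
δ x y = ⟦ does (x Fin.≟ y) ⟧

sum-δ : ∀ (x : Fin n) → sum (δ x) ≡ 1
sum-δ {suc n} zero    = cong suc (sum-replicate-zero n)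
sum-δ {suc n} (suc x) = sum-δ x

sum-const-1 : ∀ n → sum {n} (const 1) ≡ n
sum-const-1 zero    = refl
sum-const-1 (suc n) = cong suc (sum-const-1 n)

∣tabulate∣ : (f : Fin n → Bool) → ∣ Vec.tabulate f ∣ ≡ sum (⟦_⟧ ∘ f)
∣tabulate∣ {zero}  f = refl
∣tabulate∣ {suc n} f with f zero
... | true  = cong suc (∣tabulate∣ (f ∘ suc))
... | false = ∣tabulate∣ (f ∘ suc)

length-filter-tabulate : ∀ {A : Set} {P : A → Set} (P? : U.Decidable P) (f : Fin n → A) →
  length (List.filter P? (List.tabulate f)) ≡ ∣ Vec.tabulate (does ∘ P? ∘ f) ∣
length-filter-tabulate {zero}  P? f = refl
length-filter-tabulate {suc n} P? f with does (P? (f zero))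
... | true  = cong suc (length-filter-tabulate P? (f ∘ suc))
... | false = length-filter-tabulate P? (f ∘ suc)

-- For `p ≢ q`, the adjacency matrix of the graph whose only edge is `pq`.
edge : Fin n → Fin n → Fin n → Fin n → ℕ
edge p q x y = δ p x * δ q y + δ q x * δ p y

-- Symmetrised: a listed pair contributes to both of its orientations.
multiplicity : List (Fin n × Fin n) → Fin n → Fin n → ℕ
multiplicity []            x y = 0
multiplicity ((p , q) ∷ B) x y = edge p q x y + multiplicity B x y

sum-δ*δ : ∀ (p q : Fin n) → sum (λ x → sum (λ y → δ p x * δ q y)) ≡ 1
sum-δ*δ p q = trans (sum-cong-≗ row) (sum-δ p)
  where
  row : ∀ x → sum (λ y → δ p x * δ q y) ≡ δ p x
  row x = trans (sym (*-distribˡ-sum (δ p x) (δ q)))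
            (trans (cong (δ p x *_) (sum-δ q)) (*-identityʳ (δ p x)))

∑∑-distrib-+ : (f g : Fin n → Fin n → ℕ) →
  sum (λ x → sum (λ y → f x y + g x y)) ≡ sum (λ x → sum (f x)) + sum (λ x → sum (g x))
∑∑-distrib-+ f g = trans (sum-cong-≗ λ x → ∑-distrib-+ (f x) (g x))
                     (∑-distrib-+ (sum ∘ f) (sum ∘ g))

-- The handshake identity: each listed pair contributes weight 1 in each of its two orientations.
sum-multiplicity : (B : List (Fin n × Fin n)) →
  sum (λ x → sum (multiplicity B x)) ≡ length B + length B
sum-multiplicity {n} [] = trans (sum-cong-≗ {n} λ x → sum-replicate-zero n) (sum-replicate-zero n)
sum-multiplicity ((p , q) ∷ B) = begin
  sum (λ x → sum (λ y → edge p q x y + multiplicity B x y))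
    ≡⟨ ∑∑-distrib-+ (edge p q) (multiplicity B) ⟩
  sum (λ x → sum (edge p q x)) + sum (λ x → sum (multiplicity B x))
    ≡⟨ cong₂ _+_ (∑∑-distrib-+ (λ x y → δ p x * δ q y) (λ x y → δ q x * δ p y)) (sum-multiplicity B) ⟩
  (sum (λ x → sum (λ y → δ p x * δ q y)) + sum (λ x → sum (λ y → δ q x * δ p y))) + (length B + length B)
    ≡⟨ cong (_+ (length B + length B)) (cong₂ _+_ (sum-δ*δ p q) (sum-δ*δ q p)) ⟩
  2 + (length B + length B)
    ≡⟨ cong suc (+-suc (length B) (length B)) ⟨
  suc (length B) + suc (length B) ∎
  where open ≡-Reasoning

multiplicity-sym : (B : List (Fin n × Fin n)) → ∀ x y → multiplicity B x y ≡ multiplicity B y x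
multiplicity-sym []            x y = refl
multiplicity-sym ((p , q) ∷ B) x y = cong₂ _+_ edge-sym (multiplicity-sym B x y)
  where
  edge-sym : edge p q x y ≡ edge p q y x
  edge-sym = trans (+-comm (δ p x * δ q y) _)
               (cong₂ _+_ (*-comm (δ q x) (δ p y)) (*-comm (δ p x) (δ q y)))

δ*δ⁻ : ∀ (p q x y : Fin n) → 1 ≤ δ p x * δ q y → (x , y) ≡ (p , q)
δ*δ⁻ p q x y 1≤ with p Fin.≟ x | q Fin.≟ y
... | yes refl | yes refl = refl

multiplicity⁻ : (B : List (Fin n × Fin n)) → ∀ x y → 1 ≤ multiplicity B x y →
                (x , y) List.∈ B ⊎ (y , x) List.∈ B
multiplicity⁻ ((p , q) ∷ B) x y 1≤ with 1≤m+n (edge p q x y) 1≤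
... | inj₂ 1≤B = Sum.map there there (multiplicity⁻ B x y 1≤B)
... | inj₁ 1≤e with 1≤m+n (δ p x * δ q y) 1≤e
...   | inj₁ 1≤pq = inj₁ (here (δ*δ⁻ p q x y 1≤pq))
...   | inj₂ 1≤qp with refl ← δ*δ⁻ q p x y 1≤qp = inj₂ (here refl)

multiplicity⁺ : (B : List (Fin n × Fin n)) → ∀ x y → (x , y) List.∈ B → 1 ≤ multiplicity B x y
multiplicity⁺ ((x , y) ∷ B) x y (here refl) = ≤-trans
  (*-mono-≤ (⟦does⟧⁺ (x Fin.≟ x) refl) (⟦does⟧⁺ (y Fin.≟ y) refl))
  (≤-trans (m≤m+n _ (δ y x * δ x y)) (m≤m+n _ _))
multiplicity⁺ (e ∷ B) x y (there xy∈B) = ≤-trans (multiplicity⁺ B x y xy∈B) (m≤n+m _ _)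

-- Small vertex subsets and bounds on `γ`.

∣p∪q∣≤∣p∣+∣q∣ : (p q : Subset n) → ∣ p ∪ q ∣ ≤ ∣ p ∣ + ∣ q ∣
∣p∪q∣≤∣p∣+∣q∣ []            []            = z≤n
∣p∪q∣≤∣p∣+∣q∣ (inside  ∷ p) (inside  ∷ q) = s≤s (≤-trans (∣p∪q∣≤∣p∣+∣q∣ p q) (+-monoʳ-≤ ∣ p ∣ (n≤1+n _)))
∣p∪q∣≤∣p∣+∣q∣ (inside  ∷ p) (outside ∷ q) = s≤s (∣p∪q∣≤∣p∣+∣q∣ p q)
∣p∪q∣≤∣p∣+∣q∣ (outside ∷ p) (inside  ∷ q) =
  ≤-trans (s≤s (∣p∪q∣≤∣p∣+∣q∣ p q)) (≤-reflexive (sym (+-suc ∣ p ∣ ∣ q ∣)))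
∣p∪q∣≤∣p∣+∣q∣ (outside ∷ p) (outside ∷ q) = ∣p∪q∣≤∣p∣+∣q∣ p q

∣p∣≤1⇒⊆singleton : Fin n → (p : Subset n) → ∣ p ∣ ≤ 1 → ∃[ u ] ∀ {x} → x ∈ p → x ≡ u
∣p∣≤1⇒⊆singleton v p ∣p∣≤1 with any? (_∈? p)
-- For empty `p` the vertex `v` serves as a default value.
... | no p-empty = v , λ {x} x∈p → contradiction (x , x∈p) p-empty
... | yes (u , u∈p) = u , only
  where
  only : ∀ {x} → x ∈ p → x ≡ u
  only {x} x∈p with x Fin.≟ u
  ... | yes x≡u = x≡u
  ... | no  x≢u = contradiction
    (≤-trans (s≤s (≤-trans (s≤s z≤n) (x∈p⇒∣p-x∣<∣p∣ (x∈p∧x≢y⇒x∈p-y x∈p x≢u)))) (≤-trans (x∈p⇒∣p-x∣<∣p∣ u∈p) ∣p∣≤1))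
    λ { (s≤s ()) }

γ≤ : (G : Graph n) (D : Subset n) → Dominating G D → γ G ≤ ∣ D ∣
γ≤ G D dom = IsMinimum.lowerBound (proj₂ (dominationNumber G)) _ (D , dom , refl)

γ≥ : (G : Graph n) → ∀ k → (∀ D → Dominating G D → k ≤ ∣ D ∣) → k ≤ γ G
γ≥ G k k≤ with IsMinimum.attained (proj₂ (dominationNumber G))
... | D , dom , ∣D∣≡γ = subst (k ≤_) ∣D∣≡γ (k≤ D dom)

-- The complement of `G`, and the value of `γ G`.

module _ {n : ℕ} (n≥4 : n ≥ 4) (G : Graph n) (regular : Regular (n ∸ 3) G) where

  h? : ∀ x y → Dec (x ≢ y × ¬ Adj G x y)
  h? x y = ¬? (x Fin.≟ y) ×-dec ¬? (adj? G x y)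

  h : Fin n → Fin n → ℕ
  h x y = ⟦ does (h? x y) ⟧

  h-sym : ∀ x y → h x y ≡ h y x
  h-sym x y = cong ⟦_⟧ (does-⇔ (mk⇔ flip flip) (h? x y) (h? y x))
    where
    flip : ∀ {x y} → x ≢ y × ¬ Adj G x y → y ≢ x × ¬ Adj G y x
    flip (x≢y , ¬xy) = x≢y ∘ sym , ¬xy ∘ Graph.sym G

  h-irrefl : ∀ x → h x x ≡ 0
  h-irrefl x with x Fin.≟ x
  ... | yes _   = refl
  ... | no  x≢x = contradiction refl x≢x

  partition : ∀ x y → ⟦ does (adj? G x y) ⟧ + (h x y + δ x y) ≡ 1
  partition x y with x Fin.≟ y | adj? G x y
  ... | yes x≡y | yes xy = contradiction xy (Graph.irrefl G x≡y)
  ... | yes _   | no  _  = refl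
  ... | no  _   | yes _  = refl
  ... | no  _   | no  _  = refl

  -- Summing `partition` over `y` gives `(n - 3) + sum (h x) + 1 = n`; here `n ≥ 4` ensures that the
  -- subtraction is not truncated.
  h-degree : ∀ x → sum (h x) ≡ 2
  h-degree x = +-cancelʳ-≡ 1 _ 2 (+-cancelˡ-≡ (n ∸ 3) _ 3 (begin
    n ∸ 3 + (sum (h x) + 1)             ≡⟨ cong₂ (λ k l → k + (sum (h x) + l)) (trans (sym (∣tabulate∣ (does ∘ adj? G x))) (regular x)) (sum-δ x) ⟨
    sum g + (sum (h x) + sum (δ x))     ≡⟨ cong (sum g +_) (∑-distrib-+ (h x) (δ x)) ⟨
    sum g + sum (λ y → h x y + δ x y)   ≡⟨ ∑-distrib-+ g _ ⟨
    sum (λ y → g y + (h x y + δ x y))   ≡⟨ sum-cong-≗ (partition x) ⟩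
    sum {n} (const 1)                   ≡⟨ sum-const-1 n ⟩
    n                                   ≡⟨ m∸n+n≡m (≤-trans (n≤1+n 3) n≥4) ⟨
    n ∸ 3 + 3                           ∎))
    where
    open ≡-Reasoning
    g : Fin n → ℕ
    g y = ⟦ does (adj? G x y) ⟧

  -- A vertex that `u` and `v` fail to dominate in `G - B` is a common neighbour of both in the
  -- complement of `G - B`.
  many-removed : (B : EdgeSubset G) →
                 (∀ u v → u ≢ v → ¬ Dominating (G - B) (⁅ u ⁆ ∪ ⁅ v ⁆)) → n ≤ 3 + size B
  many-removed B undominated =
    TwoRegularPlus.order-bound h β h-sym (multiplicity-sym (elements B)) h-irrefl β-irrefl
      (λ x y → ⟦⟧≤1 (does (h? x y))) h-degree disjoint (sum-multiplicity (elements B)) common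
    where
    β = multiplicity (elements B)

    β⇒Adj : ∀ x y → 1 ≤ β x y → Adj G x y
    β⇒Adj x y 1≤β with multiplicity⁻ (elements B) x y 1≤β
    ... | inj₁ xy∈B = proj₂ (All.lookup (EdgeSubset.areEdges B) xy∈B)
    ... | inj₂ yx∈B = Graph.sym G (proj₂ (All.lookup (EdgeSubset.areEdges B) yx∈B))

    ¬Adj⇒β≡0 : ∀ x y → ¬ Adj G x y → β x y ≡ 0
    ¬Adj⇒β≡0 x y ¬xy = n<1⇒n≡0 (≰⇒> (¬xy ∘ β⇒Adj x y))

    β-irrefl : ∀ x → β x x ≡ 0
    β-irrefl x = ¬Adj⇒β≡0 x x (Graph.irrefl G refl)

    disjoint : ∀ x y → 1 ≤ h x y → β x y ≡ 0
    disjoint x y 1≤h = ¬Adj⇒β≡0 x y (proj₂ (⟦does⟧⁻ (h? x y) 1≤h))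

    ¬Adj⇒κ : ∀ u w → u ≢ w → ¬ Adj (G - B) w u → 1 ≤ h u w + β u w
    -- If `κ` were 0, `uw` would be an edge of `G` listed in neither orientation, hence an edge of
    -- `G - B`.
    ¬Adj⇒κ u w u≢w ¬wu = decidable-stable (1 ≤? κ) λ 1≰κ → ¬wu
      ( Graph.sym G (decidable-stable (adj? G u w) λ ¬uw →
          1≰κ (≤-trans (⟦does⟧⁺ (h? u w) (u≢w , ¬uw)) (m≤m+n _ (β u w))))
      , (λ wu∈B → 1≰κ (≤-trans (≤-trans (multiplicity⁺ (elements B) w u wu∈B)
            (≤-reflexive (multiplicity-sym (elements B) w u))) (m≤n+m _ (h u w))))
      , (λ uw∈B → 1≰κ (≤-trans (multiplicity⁺ (elements B) u w uw∈B) (m≤n+m _ (h u w)))))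
      where κ = h u w + β u w

    common : ∀ u v → u ≢ v → ∃[ w ] 1 ≤ h u w + β u w × 1 ≤ h v w + β v w
    common u v u≢v with any? (λ w → (1 ≤? h u w + β u w) ×-dec (1 ≤? h v w + β v w))
    ... | yes found = found
    ... | no ¬found = contradiction dominates (undominated u v u≢v)
      where
      dominates : Dominating (G - B) (⁅ u ⁆ ∪ ⁅ v ⁆)
      dominates w w∉ with adj? (G - B) w u | adj? (G - B) w v
      ... | yes wu | _      = u , x∈p∪q⁺ (inj₁ (x∈⁅x⁆ u)) , wu
      ... | no _   | yes wv = v , x∈p∪q⁺ (inj₂ (x∈⁅x⁆ v)) , wv
      ... | no ¬wu | no ¬wv = contradiction
        ( w
        , ¬Adj⇒κ u w (λ { refl → w∉ (x∈p∪q⁺ (inj₁ (x∈⁅x⁆ u))) }) ¬wu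
        , ¬Adj⇒κ v w (λ { refl → w∉ (x∈p∪q⁺ (inj₂ (x∈⁅x⁆ v))) }) ¬wv) ¬found

  γ>2⇒many-removed : (B : EdgeSubset G) → 3 ≤ γ (G - B) → n ≤ 3 + size B
  γ>2⇒many-removed B 3≤γ = many-removed B λ u v _ dom → contradiction
    (≤-trans 3≤γ (≤-trans (γ≤ (G - B) _ dom)
      (≤-trans (∣p∪q∣≤∣p∣+∣q∣ ⁅ u ⁆ ⁅ v ⁆) (≤-reflexive (cong₂ _+_ (∣⁅x⁆∣≡1 u) (∣⁅x⁆∣≡1 v))))))
    (<-irrefl refl)

  -- Besides itself, `u` has two non-neighbours, and at most one of them is `v`.
  non-neighbour : ∀ u v → ∃[ w ] w ≢ u × w ≢ v × ¬ Adj G w u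
  non-neighbour u v with sum-positive (h u) (≤-trans (s≤s z≤n) (≤-reflexive (sym (h-degree u))))
  ... | x , hux with sum≡2⇒second-support (h u) (h-degree u) (λ y → ⟦⟧≤1 (does (h? u y))) hux
  ... | y , y≢x , huy , _ with x Fin.≟ v
  ...   | no  x≢v  = x , proj₁ (hu x hux) , x≢v , proj₂ (hu x hux)
    where
    hu : ∀ w → 1 ≤ h u w → w ≢ u × ¬ Adj G w u
    hu w 1≤h = ⟦does⟧⁻ (h? w u) (subst (1 ≤_) (h-sym u w) 1≤h)
  ...   | yes refl = y , proj₁ hyu , y≢x , proj₂ hyu
    where
    hyu = ⟦does⟧⁻ (h? y u) (subst (1 ≤_) (h-sym u y) huy)

  vertex : Fin n
  vertex = Fin.fromℕ< (≤-trans (s≤s z≤n) n≥4)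

  2≤γ : 2 ≤ γ G
  2≤γ = γ≥ G 2 λ D dom → ≰⇒> (small D dom)
    where
    small : ∀ D → Dominating G D → ¬ ∣ D ∣ ≤ 1
    small D dom ∣D∣≤1 =
      let u , D⊆u            = ∣p∣≤1⇒⊆singleton vertex D ∣D∣≤1
          w , w≢u , _ , ¬wu  = non-neighbour u u
          z , z∈D , wz       = dom w (w≢u ∘ D⊆u)
      in ¬wu (subst (Adj G w) (D⊆u z∈D) wz)

  no-edges : EdgeSubset G
  no-edges = record { elements = [] ; unique = [] ; areEdges = [] }

  γ≤2 : γ G ≤ 2
  -- Removing no edges keeps the dominating sets, so `γ G ≥ 3` would give `n ≤ 3`.
  γ≤2 = ≮⇒≥ λ 3≤γ → <-irrefl refl (≤-trans n≥4 (γ>2⇒many-removed no-edges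
    (γ≥ (G - no-edges) 3 λ D dom → ≤-trans 3≤γ (γ≤ G D (restore D dom)))))
    where
    restore : ∀ D → Dominating (G - no-edges) D → Dominating G D
    restore D dom v v∉D = let u , u∈D , vu , _ = dom v v∉D in u , u∈D , vu

  -- Isolating a vertex by removing its edges.

  module Star (v : Fin n) where

    -- `IsEdge` admits only the increasing representative of an edge.
    orient : Fin n → Fin n × Fin n
    orient w with v Fin.<? w
    ... | yes _ = v , w
    ... | no  _ = w , v

    orient-injective : ∀ {x y} → orient x ≡ orient y → x ≡ y
    orient-injective {x} {y} eq with v Fin.<? x | v Fin.<? y | eq
    ... | yes _ | yes _ | refl = refl
    ... | yes _ | no  _ | refl = refl
    ... | no  _ | yes _ | refl = refl
    ... | no  _ | no  _ | refl = refl

    orient-edge : ∀ {w} → Adj G v w → IsEdge G (orient w)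
    orient-edge {w} vw with v Fin.<? w
    ... | yes v<w = v<w , vw
    ... | no  v≮w = Fin.≤∧≢⇒< (≮⇒≥ v≮w) (λ w≡v → Graph.irrefl G (sym w≡v) vw) , Graph.sym G vw

    orient-either : ∀ w → orient w ≡ (v , w) ⊎ orient w ≡ (w , v)
    orient-either w with v Fin.<? w
    ... | yes _ = inj₁ refl
    ... | no  _ = inj₂ refl

    star : EdgeSubset G
    star = record
      { elements = map orient (List.filter (adj? G v) (List.allFin n))
      ; unique   = Unique.map⁺ orient-injective (Unique.filter⁺ (adj? G v) (Unique.allFin⁺ n))
      ; areEdges = All.map⁺ (All.map orient-edge (All.all-filter (adj? G v) (List.allFin n)))
      }

    star-size : size star ≡ n ∸ 3
    star-size = trans (length-map orient (List.filter (adj? G v) (List.allFin n)))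
                  (trans (length-filter-tabulate (adj? G v) id) (regular v))

    isolates : ∀ w → ¬ Adj (G - star) v w
    isolates w (vw , vw∉ , wv∉) with orient-either w
    ... | inj₁ eq = vw∉ (subst (List._∈ elements star) eq (∈-map⁺ orient (∈-filter⁺ (adj? G v) (∈-allFin w) vw)))
    ... | inj₂ eq = wv∉ (subst (List._∈ elements star) eq (∈-map⁺ orient (∈-filter⁺ (adj? G v) (∈-allFin w) vw)))

    -- The isolated `v` must lie in `D`. If `D` had at most two elements, a single `u` would have to
    -- dominate every other vertex outside `D`, but some `w` distinct from `u` and `v` is not
    -- adjacent to `u`.
    γ>2 : 3 ≤ γ (G - star)
    γ>2 = γ≥ (G - star) 3 λ D dom → ≰⇒> (small D dom)
      where
      small : ∀ D → Dominating (G - star) D → ¬ ∣ D ∣ ≤ 2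
      small D dom ∣D∣≤2 =
        let u , D-v⊆u              = ∣p∣≤1⇒⊆singleton v (D Subset.- v)
                                       (s≤s⁻¹ (≤-trans (x∈p⇒∣p-x∣<∣p∣ v∈D) ∣D∣≤2))
            w , w≢u , w≢v , ¬wu    = non-neighbour u v
            z , z∈D , wz           = dom w λ w∈D → w≢u (D-v⊆u (x∈p∧x≢y⇒x∈p-y w∈D w≢v))
            z≢v = λ z≡v → isolates w (Graph.sym (G - star) (subst (Adj (G - star) w) z≡v wz))
        in ¬wu (subst (Adj G w) (D-v⊆u (x∈p∧x≢y⇒x∈p-y z∈D z≢v)) (proj₁ wz))
        where
        v∈D : v ∈ D
        v∈D = decidable-stable (v ∈? D) λ v∉D →
          let u , _ , vu = dom v v∉D in isolates u vu

theorem2p1 : (n : ℕ) → n ≥ 4 → (G : Graph n) → Regular (n ∸ 3) G → IsBondageNumber G (n ∸ 3)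
theorem2p1 n n≥4 G regular = record
  { attained   = star , star-size , ≤-trans (s≤s (γ≤2 n≥4 G regular)) γ>2
  -- Since `γ G ≥ 2`, a set B that raises `γ` gives `γ (G - B) ≥ 3`.
  ; lowerBound = λ { _ (B , refl , γ<) →
      m≤n+o⇒m∸n≤o n 3 (γ>2⇒many-removed n≥4 G regular B (≤-trans (s≤s (2≤γ n≥4 G regular)) γ<)) }
  }
  where open Star n≥4 G regular (vertex n≥4 G regular)
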